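{- For any integers $3\le c\le d$, there is no $k\in\mathbb{N}$ such that $\mathrm{SA}^k$ solves $\mathrm{PCSP}(\mathbf{K}_c,\mathbf{K}_d)$.
   Context: A signature $\sigma$ is a finite set of relation symbols with arities; a $\sigma$-structure $\mathbf{A}$ has a domain $A$ and relations $R^{\mathbf{A}}\subseteq A^{\mathrm{ar}(R)}$; a homomorphism $\mathbf{X}\to\mathbf{A}$ is a map preserving all relations (coordinatewise). $\mathbf{K}_p$ is the structure with domain $[p]$ and a single binary relation $\{(a,b)\in[p]^2:a\neq b\}$. For $\mathbf{x}=(x_1,\dots,x_r)$, $\{\mathbf{x}\}=\{x_1,\dots,x_r\}$. Sherali-Adams: for finite $\sigma$-structures $\mathbf{X},\mathbf{A}$ and $k\in\mathbb{N}$, introduce variables $\lambda_V(f)$ for each $V\subseteq X$ with $1\le|V|\le k$ and $f:V\to A$, and $\lambda_{R,\mathbf{x}}(f)$ for each $R\in\sigma$, $\mathbf{x}\in R^{\mathbf{X}}$, $f:\{\mathbf{x}\}\to A$. Constraints: (SA1) $\sum_{f:V\to A}\lambda_V(f)=1$ for all $V$ with $1\le|V|\le k$; (SA2) $\lambda_U(f)=\sum_{g:V\to A,\,g|_U=f}\lambda_V(g)$ for $U\subseteq V\subseteq X$, $1\le|U|$, $|V|\le k$, $f:U\to A$; (SA3) $\lambda_U(f)=\sum_{g:\{\mathbf{x}\}\to A,\,g|_U=f}\lambda_{R,\mathbf{x}}(g)$ for $R\in\sigma$, $\mathbf{x}\in R^{\mathbf{X}}$, $U\subseteq\{\mathbf{x}\}$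 with $1\le|U|\le k$, $f:U\to A$; (SA4) $\lambda_{R,\mathbf{x}}(f)=0$ whenever $f(\mathbf{x})\notin R^{\mathbf{A}}$. $\mathrm{SA}^k(\mathbf{X},\mathbf{A})$ accepts if this system has a solution with all variables real in $[0,1]$. For a PCSP template $(\mathbf{A},\mathbf{B})$ (i.e. $\mathbf{A}\to\mathbf{B}$), $\mathrm{SA}^k$ solves $\mathrm{PCSP}(\mathbf{A},\mathbf{B})$ if for every finite $\sigma$-structure $\mathbf{X}$: (i) if $\mathbf{X}\to\mathbf{A}$ then $\mathrm{SA}^k(\mathbf{X},\mathbf{A})$ accepts, and (ii) if $\mathrm{SA}^k(\mathbf{X},\mathbf{A})$ accepts then $\mathbf{X}\to\mathbf{B}$. -}

module Defs where

open import Data.Nat using (ℕ; zero; suc)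
import Data.Nat as N
open import Data.Fin using (Fin; _≟_)
open import Data.Bool using (Bool; true; false; if_then_else_)
open import Data.Maybe using (Maybe; just; nothing; is-just)
import Data.Maybe.Properties as MaybeP
open import Data.Vec using (Vec; []; _∷_; lookup; zipWith)
import Data.Vec as Vec
import Data.Vec.Properties as VecP
open import Data.List using (List; []; _∷_; [_]; map; concatMap; filter; foldr; allFin)
open import Data.Fin.Subset using (Subset; ⁅_⁆; _∪_; _⊆_; ∣_∣)
open import Data.Rational using (ℚ; 0ℚ; 1ℚ; _+_; _≤_)
open import Data.Product using (Σ; _×_)
open import Relation.Binary.PropositionalEquality using (_≡_; _≢_)
open import Relation.Nullary using (¬_)

record Str : Set₁ where
  field
    size : ℕ
    R    : Fin size → Fin size → Set
open Str public

K : ℕ → Str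
K p = record { size = p ; R = λ a b → a ≢ b }

Hom : Str → Str → Set
Hom X A = Σ (Fin (size X) → Fin (size A))
            λ h → ∀ x y → R X x y → R A (h x) (h y)

-- Partial assignments X ⇀ A.  A map f : V → A with V ⊆ X is represented
-- by a vector with entry (just (f x)) for x ∈ V and nothing otherwise.

PAssign : ℕ → ℕ → Set
PAssign n p = Vec (Maybe (Fin p)) n

dom : ∀ {n p} → PAssign n p → Subset n
dom = Vec.map is-just

restrict : ∀ {n p} → Subset n → PAssign n p → PAssign n p
restrict = zipWith (λ b m → if b then m else nothing)

assignsOn : ∀ {n} p → Subset n → List (PAssign n p)
assignsOn p [] = [ [] ]
assignsOn p (true ∷ U) =
  concatMap (λ a → map (just a ∷_) (assignsOn p U)) (allFin p)
assignsOn p (false ∷ U) = map (nothing ∷_) (assignsOn p U)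

sumℚ : List ℚ → ℚ
sumℚ = foldr _+_ 0ℚ

_≟PA_ : ∀ {n p} (f g : PAssign n p) → Relation.Nullary.Dec (f ≡ g)
_≟PA_ = VecP.≡-dec (MaybeP.≡-dec _≟_)
  where import Relation.Nullary

sumExt : ∀ {n p} → (PAssign n p → ℚ) → Subset n → Subset n → PAssign n p → ℚ
sumExt {p = p} lam V U f =
  sumℚ (map lam (filter (λ g → restrict U g ≟PA f) (assignsOn p V)))

pair : ∀ {n} → Fin n → Fin n → Subset n
pair x y = ⁅ x ⁆ ∪ ⁅ y ⁆

inUnit : ℚ → Set
inUnit q = (0ℚ ≤ q) × (q ≤ 1ℚ)

-- Sherali–Adams relaxation SA^k(X, A): a solution of (SA1)–(SA4) with
-- all variables in [0,1].  Variables: lamV f  ≙ λ_{dom f}(f)  (used for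
-- 1 ≤ |dom f| ≤ k) and lamR x y e f ≙ λ_{R,(x,y)}(f) (used for
-- dom f = {x,y}).

record SASolution (k : ℕ) (X A : Str) : Set where
  field
    lamV : PAssign (size X) (size A) → ℚ
    lamR : (x y : Fin (size X)) → R X x y → PAssign (size X) (size A) → ℚ
    rangeV : ∀ f → 1 N.≤ ∣ dom f ∣ → ∣ dom f ∣ N.≤ k → inUnit (lamV f)
    rangeR : ∀ x y (e : R X x y) f → dom f ≡ pair x y → inUnit (lamR x y e f)
    SA1 : ∀ (V : Subset (size X)) → 1 N.≤ ∣ V ∣ → ∣ V ∣ N.≤ k →
          sumℚ (map lamV (assignsOn (size A) V)) ≡ 1ℚ
    SA2 : ∀ (U V : Subset (size X)) → U ⊆ V → 1 N.≤ ∣ U ∣ → ∣ V ∣ N.≤ k →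
          ∀ f → dom f ≡ U → lamV f ≡ sumExt lamV V U f
    SA3 : ∀ x y (e : R X x y) (U : Subset (size X)) → U ⊆ pair x y →
          1 N.≤ ∣ U ∣ → ∣ U ∣ N.≤ k →
          ∀ f → dom f ≡ U → lamV f ≡ sumExt (lamR x y e) (pair x y) U f
    SA4 : ∀ x y (e : R X x y) f → dom f ≡ pair x y →
          ∀ a b → lookup f x ≡ just a → lookup f y ≡ just b →
          ¬ R A a b → lamR x y e f ≡ 0ℚ

SAaccepts : ℕ → Str → Str → Set
SAaccepts k X A = SASolution k X A

SAsolves : ℕ → Str → Str → Set₁
SAsolves k A B = ∀ (X : Str) → (Hom X A → SAaccepts k X A) × (SAaccepts k X A → Hom X B)

-- The witness is the j-th iterated arc graph X = δ^ j (K N), for N huge.  Colours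
-- of arcs can be traded for sets of colours of vertices, so a d-colouring of X
-- gives a colouring of K N with a tower of exponentials in d many colours, which
-- is impossible.  On the other hand a vertex of X involves at most 2 ^ j elements
-- of [N].  If (2 + k) * 2 ^ j ≤ C, then the elements involved in a set of at most
-- 2 + k vertices of X can be mapped to [C] by a uniformly random injection; this
-- sends those vertices to δ^ j (K C), which is 3-colourable for suitable j and C
-- (Cole–Vishkin colour reduction).  Marginals of uniform injections are uniform
-- injections, so the induced distributions on colourings solve SA^k.
module Submission where

open import Defs
open import Data.Nat using (ℕ; _≤_)
open import Data.Product using (Σ)
open import Relation.Nullary using (¬_)

open import Data.Bool using (true; false; if_then_else_)
open import Data.Empty using (⊥)
open import Data.Fin using (Fin; zero; suc; _≟_; combine; remQuot; finToFun; funToFin; inject≤; fromℕ<)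
open import Data.Fin.Properties using
  (remQuot-combine; combine-injective; finToFun-funToFin; funToFin-finToFin; inject≤-injective; pigeonhole; any?; <⇒≢)
open import Data.Fin.Subset using (Subset; _∈_; _⊆_; ∣_∣; _-_; _∪_; ⁅_⁆; ⊤) renaming (⊥ to ∅)
open import Data.Fin.Subset.Properties using
  ( _∈?_; ∣⊥∣≡0; ∣⊤∣≡n; ∣⁅x⁆∣≡1; ∉⊥; x∈⁅x⁆; x∈p∪q⁺; x∈p∪q⁻; p─⊥≡p; p─q⊆p; p─x─y≡p─y─x
  ; x∈p∧x≢y⇒x∈p-y; drop-∷-⊆; p⊆q⇒∣p∣≤∣q∣)
open import Data.List using (List; []; _∷_; map; _++_; concatMap; filter; allFin)
import Data.List.Membership.Propositional as List
open import Data.List.Membership.Propositional.Properties using (∈-map⁻; ∈-concatMap⁻)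
open import Data.List.Properties using (map-tabulate; map-∘)
open import Data.List.Relation.Unary.Any as Any using (here; there)
open import Data.Maybe using (just; nothing)
open import Data.Maybe.Properties using (just-injective)
open import Data.Nat as ℕ using (zero; suc; z≤n; s≤s)
import Data.Nat.Properties as ℕ
open import Data.Nat.Tactic.RingSolver using (solve-∀)
open import Data.Product using (∃; ∃₂; _×_; _,_; proj₁; proj₂)
open import Data.Rational as ℚ using (ℚ; 0ℚ; 1ℚ; _+_; _*_; 1/_; Positive; NonNegative; nonNegative)
open import Data.Rational.Properties as ℚ using
  ( +-assoc; +-comm; +-identityˡ; +-identityʳ; +-mono-≤; *-assoc; *-comm; *-identityˡ; *-identityʳ
  ; *-zeroˡ; *-zeroʳ; *-distribˡ-+; *-inverseˡ; *-monoˡ-≤-nonNeg; nonNegative⁻¹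
  ; nonNeg+nonNeg⇒nonNeg; pos+nonNeg⇒pos; pos⇒nonZero; pos⇒nonNeg; 1/pos⇒pos)
open import Data.Sum using (inj₁; inj₂)
open import Data.Vec using (Vec; []; _∷_; lookup; here; there)
open import Data.Vec.Properties using (∷-injectiveˡ; ∷-injectiveʳ)
open import Function using (_∘_; id; mk⇔; _⇔_)
open import Relation.Binary.PropositionalEquality using
  (_≡_; _≢_; refl; sym; trans; cong; cong₂; subst; module ≡-Reasoning)
open import Relation.Nullary using (Dec; yes; no; does; contradiction; ¬?)
open import Relation.Nullary.Decidable using (_×-dec_; does-⇔; decidable-stable)

private variable
  I J P Q : Set
  G H : Str
  n : ℕ

-- Indicators and finite sums of rationals.

𝟙 : Dec P → ℚ
𝟙 d = if does d then 1ℚ else 0ℚ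

𝟙-⇔ : (p : Dec P) (q : Dec Q) → P ⇔ Q → 𝟙 p ≡ 𝟙 q
𝟙-⇔ p q e = cong (if_then 1ℚ else 0ℚ) (does-⇔ e p q)

𝟙-× : (p : Dec P) (q : Dec Q) → 𝟙 p * 𝟙 q ≡ 𝟙 (p ×-dec q)
𝟙-× (yes _) q = *-identityˡ (𝟙 q)
𝟙-× (no _)  q = *-zeroˡ (𝟙 q)

𝟙-no : (p : Dec P) → ¬ P → 𝟙 p ≡ 0ℚ
𝟙-no (yes p) ¬p = contradiction p ¬p
𝟙-no (no _)  _  = refl

0≤1 : 0ℚ ℚ.≤ 1ℚ
0≤1 = nonNegative⁻¹ 1ℚ

𝟙-nonNeg : (p : Dec P) → 0ℚ ℚ.≤ 𝟙 p
𝟙-nonNeg (yes _) = 0≤1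
𝟙-nonNeg (no _)  = ℚ.≤-refl

𝟙≤1 : (p : Dec P) → 𝟙 p ℚ.≤ 1ℚ
𝟙≤1 (yes _) = ℚ.≤-refl
𝟙≤1 (no _)  = 0≤1

𝟙-*-cong : (p : Dec P) {x y : ℚ} → (P → x ≡ y) → 𝟙 p * x ≡ 𝟙 p * y
𝟙-*-cong (yes p) x≡y = cong (1ℚ *_) (x≡y p)
𝟙-*-cong (no _) {x} {y} _ = trans (*-zeroˡ x) (sym (*-zeroˡ y))

*-swap : ∀ x y z → x * (y * z) ≡ y * (x * z)
*-swap x y z = trans (sym (*-assoc x y z)) (trans (cong (_* z) (*-comm x y)) (*-assoc y x z))

+-interchange : ∀ w x y z → (w + x) + (y + z) ≡ (w + y) + (x + z)
+-interchange w x y z = trans (+-assoc w x (y + z))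
  (trans (cong (w +_) (trans (sym (+-assoc x y z)) (trans (cong (_+ z) (+-comm x y)) (+-assoc y x z))))
         (sym (+-assoc w y (x + z))))

∑ : List I → (I → ℚ) → ℚ
∑ xs F = sumℚ (map F xs)

∑-cong-∈ : (xs : List I) {F G : I → ℚ} → (∀ {x} → x List.∈ xs → F x ≡ G x) → ∑ xs F ≡ ∑ xs G
∑-cong-∈ []       _ = refl
∑-cong-∈ (x ∷ xs) e = cong₂ _+_ (e (here refl)) (∑-cong-∈ xs (e ∘ there))

∑-cong : (xs : List I) {F G : I → ℚ} → (∀ x → F x ≡ G x) → ∑ xs F ≡ ∑ xs G
∑-cong xs e = ∑-cong-∈ xs (λ {x} _ → e x)

∑-mono : (xs : List I) {F G : I → ℚ} → (∀ x → F x ℚ.≤ G x) → ∑ xs F ℚ.≤ ∑ xs G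
∑-mono []       _ = ℚ.≤-refl
∑-mono (x ∷ xs) e = +-mono-≤ (e x) (∑-mono xs e)

∑-zero : (xs : List I) → ∑ xs (λ _ → 0ℚ) ≡ 0ℚ
∑-zero []       = refl
∑-zero (x ∷ xs) = trans (+-identityˡ _) (∑-zero xs)

∑-+ : (xs : List I) (F G : I → ℚ) → ∑ xs (λ x → F x + G x) ≡ ∑ xs F + ∑ xs G
∑-+ []       F G = refl
∑-+ (x ∷ xs) F G = trans (cong (F x + G x +_) (∑-+ xs F G)) (+-interchange (F x) (G x) _ _)

∑-*ˡ : (xs : List I) (q : ℚ) (F : I → ℚ) → ∑ xs (λ x → q * F x) ≡ q * ∑ xs F
∑-*ˡ []       q F = sym (*-zeroʳ q)
∑-*ˡ (x ∷ xs) q F = trans (cong (q * F x +_) (∑-*ˡ xs q F)) (sym (*-distribˡ-+ q _ _))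

∑-comm : (xs : List I) (ys : List J) (F : I → J → ℚ) →
         ∑ xs (λ x → ∑ ys (F x)) ≡ ∑ ys (λ y → ∑ xs (λ x → F x y))
∑-comm []       ys F = sym (∑-zero ys)
∑-comm (x ∷ xs) ys F = trans (cong (∑ ys (F x) +_) (∑-comm xs ys F)) (sym (∑-+ ys (F x) _))

∑-++ : (xs ys : List I) (F : I → ℚ) → ∑ (xs ++ ys) F ≡ ∑ xs F + ∑ ys F
∑-++ []       ys F = sym (+-identityˡ _)
∑-++ (x ∷ xs) ys F = trans (cong (F x +_) (∑-++ xs ys F)) (sym (+-assoc (F x) _ _))

∑-map : (h : I → J) (xs : List I) (F : J → ℚ) → ∑ (map h xs) F ≡ ∑ xs (F ∘ h)
∑-map h xs F = cong sumℚ (sym (map-∘ xs))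

∑-concatMap : (h : I → List J) (xs : List I) (F : J → ℚ) →
              ∑ (concatMap h xs) F ≡ ∑ xs (λ x → ∑ (h x) F)
∑-concatMap h []       F = refl
∑-concatMap h (x ∷ xs) F = trans (∑-++ (h x) _ F) (cong (∑ (h x) F +_) (∑-concatMap h xs F))

∑-filter : {P : I → Set} (P? : ∀ x → Dec (P x)) (xs : List I) (F : I → ℚ) →
           ∑ (filter P? xs) F ≡ ∑ xs (λ x → 𝟙 (P? x) * F x)
∑-filter P? []       F = refl
∑-filter P? (x ∷ xs) F with P? x
... | yes _ = cong₂ _+_ (sym (*-identityˡ (F x))) (∑-filter P? xs F)
... | no _  = trans (∑-filter P? xs F)
                (sym (trans (cong (_+ _) (*-zeroˡ (F x))) (+-identityˡ _)))

∑-allFin-suc : ∀ {n} (F : Fin (suc n) → ℚ) → ∑ (allFin (suc n)) F ≡ F zero + ∑ (allFin n) (F ∘ suc)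
∑-allFin-suc {n} F = cong (F zero +_)
  (trans (cong (λ xs → ∑ xs F) (sym (map-tabulate id suc))) (∑-map suc (allFin n) F))

∑-𝟙≟ : ∀ {n} (b : Fin n) (F : Fin n → ℚ) → ∑ (allFin n) (λ a → 𝟙 (b ≟ a) * F a) ≡ F b
∑-𝟙≟ {suc n} zero F = begin
  ∑ (allFin (suc n)) (λ a → 𝟙 (zero ≟ a) * F a)
    ≡⟨ ∑-allFin-suc (λ a → 𝟙 (zero ≟ a) * F a) ⟩
  1ℚ * F zero + ∑ (allFin n) (λ a → 0ℚ * F (suc a))
    ≡⟨ cong₂ _+_ (*-identityˡ (F zero))
         (trans (∑-cong (allFin n) (λ a → *-zeroˡ (F (suc a)))) (∑-zero (allFin n))) ⟩
  F zero + 0ℚ  ≡⟨ +-identityʳ (F zero) ⟩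
  F zero ∎
  where open ≡-Reasoning
∑-𝟙≟ {suc n} (suc b) F = begin
  ∑ (allFin (suc n)) (λ a → 𝟙 (suc b ≟ a) * F a)
    ≡⟨ ∑-allFin-suc (λ a → 𝟙 (suc b ≟ a) * F a) ⟩
  0ℚ * F zero + ∑ (allFin n) (λ a → 𝟙 (b ≟ a) * F (suc a))
    ≡⟨ cong₂ _+_ (*-zeroˡ (F zero)) (∑-𝟙≟ b (F ∘ suc)) ⟩
  0ℚ + F (suc b)  ≡⟨ +-identityˡ (F (suc b)) ⟩
  F (suc b) ∎
  where open ≡-Reasoning

-- Cardinalities as rationals, and subsets with a point removed.

ι : ℕ → ℚ
ι zero    = 0ℚ
ι (suc n) = 1ℚ + ι n

ι-nonNeg : ∀ n → NonNegative (ι n)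
ι-nonNeg zero    = _
ι-nonNeg (suc n) = nonNeg+nonNeg⇒nonNeg 1ℚ (ι n) {{ι-nonNeg n}}

ι-suc-pos : ∀ n → Positive (ι (suc n))
ι-suc-pos n = pos+nonNeg⇒pos 1ℚ (ι n) {{ι-nonNeg n}}

-- The value at `zero` is a default that makes the reciprocal total; an average over an empty set is
-- thereby 0.
inv : ℕ → ℚ
inv zero    = 0ℚ
inv (suc n) = 1/_ (ι (suc n)) {{pos⇒nonZero (ι (suc n)) {{ι-suc-pos n}}}}

inv-nonNeg : ∀ n → NonNegative (inv n)
inv-nonNeg zero    = _
inv-nonNeg (suc n) = pos⇒nonNeg (inv (suc n)) {{1/pos⇒pos (ι (suc n)) {{ι-suc-pos n}}}}

inv-inverse : ∀ n → inv (suc n) * ι (suc n) ≡ 1ℚ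
inv-inverse n = *-inverseˡ (ι (suc n)) {{pos⇒nonZero (ι (suc n)) {{ι-suc-pos n}}}}

∑-𝟙∈ : ∀ {n} (A : Subset n) → ∑ (allFin n) (λ a → 𝟙 (a ∈? A)) ≡ ι ∣ A ∣
∑-𝟙∈ []          = refl
∑-𝟙∈ (true  ∷ A) = trans (∑-allFin-suc (λ a → 𝟙 (a ∈? (true ∷ A)))) (cong (1ℚ +_) (∑-𝟙∈ A))
∑-𝟙∈ (false ∷ A) = trans (∑-allFin-suc (λ a → 𝟙 (a ∈? (false ∷ A))))
  (trans (+-identityˡ (∑ (allFin _) (λ a → 𝟙 (a ∈? A)))) (∑-𝟙∈ A))

x∈p-y⇒x≢y : ∀ {n} (p : Subset n) {x y} → x ∈ p - y → x ≢ y
x∈p-y⇒x≢y (_ ∷ p) {y = zero}  () refl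
x∈p-y⇒x≢y (_ ∷ p) {y = suc y} (there x∈) refl = x∈p-y⇒x≢y p x∈ refl

x∈p-y⇒x∈p : ∀ {n} (p : Subset n) {x y} → x ∈ p - y → x ∈ p
x∈p-y⇒x∈p p {y = y} = p─q⊆p p _

∣p∣≡1+∣p-x∣ : ∀ {n} (p : Subset n) {x} → x ∈ p → ∣ p ∣ ≡ suc ∣ p - x ∣
∣p∣≡1+∣p-x∣ (_ ∷ p)     here       = cong (suc ∘ ∣_∣) (sym (p─⊥≡p p))
∣p∣≡1+∣p-x∣ (true ∷ p)  (there x∈) = cong suc (∣p∣≡1+∣p-x∣ p x∈)
∣p∣≡1+∣p-x∣ (false ∷ p) (there x∈) = ∣p∣≡1+∣p-x∣ p x∈

k<∣p∣⇒k≤∣p-x∣ : ∀ {n k} (p : Subset n) {x} → x ∈ p → k ℕ.< ∣ p ∣ → k ℕ.≤ ∣ p - x ∣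
k<∣p∣⇒k≤∣p-x∣ {k = k} p x∈p lt = ℕ.s≤s⁻¹ (subst (k ℕ.<_) (∣p∣≡1+∣p-x∣ p x∈p) lt)

-- Uniform averages and uniformly random injections.

module _ {C : ℕ} where

  avg : Subset C → (Fin C → ℚ) → ℚ
  avg A F = inv ∣ A ∣ * ∑ (allFin C) (λ a → 𝟙 (a ∈? A) * F a)

  avg-cong : ∀ A {F G : Fin C → ℚ} → (∀ {a} → a ∈ A → F a ≡ G a) → avg A F ≡ avg A G
  avg-cong A e = cong (inv ∣ A ∣ *_) (∑-cong (allFin C) (λ a → 𝟙-*-cong (a ∈? A) e))

  avg-mono : ∀ A {F G : Fin C → ℚ} → (∀ a → F a ℚ.≤ G a) → avg A F ℚ.≤ avg A G
  avg-mono A F≤G = *-monoˡ-≤-nonNeg (inv ∣ A ∣) {{inv-nonNeg ∣ A ∣}}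
    (∑-mono (allFin C) (λ a → *-monoˡ-≤-nonNeg (𝟙 (a ∈? A)) {{nonNegative (𝟙-nonNeg (a ∈? A))}} (F≤G a)))

  avg-const : ∀ A q → 0 ℕ.< ∣ A ∣ → avg A (λ _ → q) ≡ q
  avg-const A q 0<∣A∣ with ∣ A ∣ | ∑-𝟙∈ A
  ... | suc n | ∑𝟙≡ = begin
    inv (suc n) * ∑ (allFin C) (λ a → 𝟙 (a ∈? A) * q)
      ≡⟨ cong (inv (suc n) *_) (∑-cong (allFin C) (λ a → *-comm (𝟙 (a ∈? A)) q)) ⟩
    inv (suc n) * ∑ (allFin C) (λ a → q * 𝟙 (a ∈? A))
      ≡⟨ cong (inv (suc n) *_) (trans (∑-*ˡ (allFin C) q _) (cong (q *_) ∑𝟙≡)) ⟩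
    inv (suc n) * (q * ι (suc n))  ≡⟨ *-swap (inv (suc n)) q _ ⟩
    q * (inv (suc n) * ι (suc n))  ≡⟨ cong (q *_) (inv-inverse n) ⟩
    q * 1ℚ                         ≡⟨ *-identityʳ q ⟩
    q ∎
    where open ≡-Reasoning

  avg-*ˡ : ∀ A q F → avg A (λ a → q * F a) ≡ q * avg A F
  avg-*ˡ A q F = trans
    (cong (inv ∣ A ∣ *_) (trans (∑-cong (allFin C) (λ a → *-swap (𝟙 (a ∈? A)) q (F a))) (∑-*ˡ (allFin C) q _)))
    (*-swap (inv ∣ A ∣) q _)

  avg-∑ : ∀ A (xs : List I) (F : Fin C → I → ℚ) →
          avg A (λ a → ∑ xs (F a)) ≡ ∑ xs (λ x → avg A (λ a → F a x))
  avg-∑ A xs F = begin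
    inv ∣ A ∣ * ∑ (allFin C) (λ a → 𝟙 (a ∈? A) * ∑ xs (F a))
      ≡⟨ cong (inv ∣ A ∣ *_) (∑-cong (allFin C) (λ a → sym (∑-*ˡ xs (𝟙 (a ∈? A)) (F a)))) ⟩
    inv ∣ A ∣ * ∑ (allFin C) (λ a → ∑ xs (λ x → 𝟙 (a ∈? A) * F a x))
      ≡⟨ cong (inv ∣ A ∣ *_) (∑-comm (allFin C) xs _) ⟩
    inv ∣ A ∣ * ∑ xs (λ x → ∑ (allFin C) (λ a → 𝟙 (a ∈? A) * F a x))
      ≡⟨ sym (∑-*ˡ xs (inv ∣ A ∣) _) ⟩
    ∑ xs (λ x → avg A (λ a → F a x)) ∎
    where open ≡-Reasoning

  private
    -- Brings a draw of two elements without replacement into the form of a double sum over ordered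
    -- pairs, with a normalising factor that does not depend on the first draw.
    avg² : ∀ A (F : Fin C → Fin C → ℚ) →
      avg A (λ a → avg (A - a) (F a)) ≡
      inv ∣ A ∣ * (inv (ℕ.pred ∣ A ∣) *
        ∑ (allFin C) (λ a → ∑ (allFin C) (λ b → 𝟙 (a ∈? A ×-dec b ∈? (A - a)) * F a b)))
    avg² A F = cong (inv ∣ A ∣ *_) (trans (∑-cong (allFin C) row) (∑-*ˡ (allFin C) (inv (ℕ.pred ∣ A ∣)) _))
      where
      row : ∀ a → 𝟙 (a ∈? A) * avg (A - a) (F a) ≡
                  inv (ℕ.pred ∣ A ∣) * ∑ (allFin C) (λ b → 𝟙 (a ∈? A ×-dec b ∈? (A - a)) * F a b)
      row a = begin
        𝟙 (a ∈? A) * avg (A - a) (F a)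
          -- The size of `A - a` is `pred ∣ A ∣` only for `a` in `A`; the indicator in front
          -- supplies that.
          ≡⟨ 𝟙-*-cong (a ∈? A) (λ a∈A → cong (λ n → inv (ℕ.pred n) * S) (sym (∣p∣≡1+∣p-x∣ A a∈A))) ⟩
        𝟙 (a ∈? A) * (inv (ℕ.pred ∣ A ∣) * S)
          ≡⟨ *-swap (𝟙 (a ∈? A)) (inv (ℕ.pred ∣ A ∣)) S ⟩
        inv (ℕ.pred ∣ A ∣) * (𝟙 (a ∈? A) * S)
          ≡⟨ cong (inv (ℕ.pred ∣ A ∣) *_) (trans (sym (∑-*ˡ (allFin C) (𝟙 (a ∈? A)) _)) (∑-cong (allFin C) λ b →
               trans (sym (*-assoc (𝟙 (a ∈? A)) (𝟙 (b ∈? (A - a))) (F a b))) (cong (_* F a b) (𝟙-× (a ∈? A) (b ∈? (A - a)))))) ⟩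
        inv (ℕ.pred ∣ A ∣) * ∑ (allFin C) (λ b → 𝟙 (a ∈? A ×-dec b ∈? (A - a)) * F a b) ∎
        where
        open ≡-Reasoning
        S = ∑ (allFin C) (λ b → 𝟙 (b ∈? (A - a)) * F a b)

  -- Exchangeability of two draws without replacement: the condition on a pair in `avg²` is
  -- symmetric, so the two sums may be swapped.
  avg-comm : ∀ A (F : Fin C → Fin C → ℚ) →
             avg A (λ a → avg (A - a) (F a)) ≡ avg A (λ b → avg (A - b) (λ a → F a b))
  avg-comm A F = trans (avg² A F) (trans
    (cong (λ s → inv ∣ A ∣ * (inv (ℕ.pred ∣ A ∣) * s))
      (trans (∑-comm (allFin C) (allFin C) _)
        (∑-cong (allFin C) λ b → ∑-cong (allFin C) λ a →
          cong (_* F a b) (𝟙-⇔ (a ∈? A ×-dec b ∈? (A - a)) (b ∈? A ×-dec a ∈? (A - b)) (mk⇔ flip flip)))))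
    (sym (avg² A _)))
    where
    flip : ∀ {a b} → a ∈ A × b ∈ A - a → b ∈ A × a ∈ A - b
    flip (a∈ , b∈) = x∈p-y⇒x∈p A b∈ , x∈p∧x≢y⇒x∈p-y a∈ (x∈p-y⇒x≢y A b∈ ∘ sym)

  Agree : ∀ {n} → Subset n → (h h′ : Vec (Fin C) n) → Set
  Agree T h h′ = ∀ {i} → i ∈ T → lookup h i ≡ lookup h′ i

  LocalTo : ∀ {n} → Subset n → (Vec (Fin C) n → ℚ) → Set
  LocalTo T φ = ∀ h h′ → Agree T h h′ → φ h ≡ φ h′

  InjectiveOn : ∀ {n} → Subset n → Vec (Fin C) n → Set
  InjectiveOn T h = ∀ {i j} → i ∈ T → j ∈ T → lookup h i ≡ lookup h j → i ≡ j

  agree-∷ : ∀ {n} (T : Subset n) {b a h h′} → Agree T h h′ → Agree (b ∷ T) (a ∷ h) (a ∷ h′)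
  agree-∷ T e here       = refl
  agree-∷ T e (there i∈) = e i∈

  module _ (c₀ : Fin C) where

    -- The expectation of φ h when h maps T injectively into A, uniformly at
    -- random, and takes the junk value c₀ outside T.
    E : ∀ {n} → Subset n → Subset C → (Vec (Fin C) n → ℚ) → ℚ
    E []          A φ = φ []
    E (false ∷ T) A φ = E T A (φ ∘ (c₀ ∷_))
    E (true  ∷ T) A φ = avg A (λ a → E T (A - a) (φ ∘ (a ∷_)))

    -- Each value is drawn from what the earlier draws have left of `A`, so only injections of `T`
    -- into `A` contribute to the expectation.
    E-cong-injective : ∀ {n} (T : Subset n) A {φ ψ : Vec (Fin C) n → ℚ} →
      (∀ h → (∀ {i} → i ∈ T → lookup h i ∈ A) → InjectiveOn T h → φ h ≡ ψ h) → E T A φ ≡ E T A ψ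
    E-cong-injective [] A e = e [] (λ ()) (λ ())
    E-cong-injective (false ∷ T) A e = E-cong-injective T A λ h h∈ inj → e (c₀ ∷ h)
      (λ { (there i∈) → h∈ i∈ })
      (λ { (there i∈) (there j∈) eq → cong suc (inj i∈ j∈ eq) })
    E-cong-injective (true ∷ T) A e = avg-cong A λ {a} a∈A → E-cong-injective T (A - a) λ h h∈ inj → e (a ∷ h)
      (λ { here → a∈A ; (there i∈) → x∈p-y⇒x∈p A (h∈ i∈) })
      (λ { here here eq → refl
         ; here (there j∈) eq → contradiction (sym eq) (x∈p-y⇒x≢y A (h∈ j∈))
         ; (there i∈) here eq → contradiction eq (x∈p-y⇒x≢y A (h∈ i∈))
         ; (there i∈) (there j∈) eq → cong suc (inj i∈ j∈ eq) })

    E-cong : ∀ {n} (T : Subset n) A {φ ψ : Vec (Fin C) n → ℚ} → (∀ h → φ h ≡ ψ h) → E T A φ ≡ E T A ψ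
    E-cong T A e = E-cong-injective T A (λ h _ _ → e h)

    E-mono : ∀ {n} (T : Subset n) A {φ ψ : Vec (Fin C) n → ℚ} → (∀ h → φ h ℚ.≤ ψ h) → E T A φ ℚ.≤ E T A ψ
    E-mono []          A e = e []
    E-mono (false ∷ T) A e = E-mono T A (e ∘ (c₀ ∷_))
    E-mono (true  ∷ T) A e = avg-mono A (λ a → E-mono T (A - a) (e ∘ (a ∷_)))

    E-*ˡ : ∀ {n} (T : Subset n) A q (φ : Vec (Fin C) n → ℚ) → E T A (λ h → q * φ h) ≡ q * E T A φ
    E-*ˡ []          A q φ = refl
    E-*ˡ (false ∷ T) A q φ = E-*ˡ T A q _
    E-*ˡ (true  ∷ T) A q φ = trans (avg-cong A (λ {a} _ → E-*ˡ T (A - a) q _)) (avg-*ˡ A q _)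

    E-∑ : ∀ {n} (T : Subset n) A (xs : List I) (φ : Vec (Fin C) n → I → ℚ) →
          E T A (λ h → ∑ xs (φ h)) ≡ ∑ xs (λ x → E T A (λ h → φ h x))
    E-∑ []          A xs φ = refl
    E-∑ (false ∷ T) A xs φ = E-∑ T A xs _
    E-∑ (true  ∷ T) A xs φ = trans (avg-cong A (λ {a} _ → E-∑ T (A - a) xs _)) (avg-∑ A xs _)

    -- The size bound keeps the set of remaining values nonempty at every draw.
    E-const : ∀ {n} (T : Subset n) A q → ∣ T ∣ ℕ.≤ ∣ A ∣ → E T A (λ _ → q) ≡ q
    E-const []          A q le = refl
    E-const (false ∷ T) A q le = E-const T A q le
    E-const (true  ∷ T) A q le = trans
      (avg-cong A (λ {a} a∈A → E-const T (A - a) q (k<∣p∣⇒k≤∣p-x∣ A a∈A le)))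
      (avg-const A q (ℕ.≤-trans (ℕ.s≤s ℕ.z≤n) le))

    -- A spare value drawn first and discarded does not bias the injection: `avg-comm` moves the
    -- spare draw past the draws for `T`, until it averages a constant. The strict bound reserves a
    -- value for it.
    avg-E : ∀ {n} (T : Subset n) A φ → ∣ T ∣ ℕ.< ∣ A ∣ → avg A (λ a → E T (A - a) φ) ≡ E T A φ
    avg-E []          A φ lt = avg-const A _ lt
    avg-E (false ∷ T) A φ lt = avg-E T A _ lt
    avg-E (true  ∷ T) A φ lt = begin
      avg A (λ a → avg (A - a) (λ b → E T (A - a - b) (φ ∘ (b ∷_))))
        ≡⟨ avg-comm A _ ⟩
      avg A (λ b → avg (A - b) (λ a → E T (A - a - b) (φ ∘ (b ∷_))))
        ≡⟨ avg-cong A (λ {b} _ → avg-cong (A - b) λ {a} _ →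
             cong (λ B → E T B (φ ∘ (b ∷_))) (p─x─y≡p─y─x A a b)) ⟩
      avg A (λ b → avg (A - b) (λ a → E T (A - b - a) (φ ∘ (b ∷_))))
        ≡⟨ avg-cong A (λ {b} b∈A → avg-E T (A - b) _
             (k<∣p∣⇒k≤∣p-x∣ A b∈A lt)) ⟩
      avg A (λ b → E T (A - b) (φ ∘ (b ∷_))) ∎
      where open ≡-Reasoning

    -- Marginals of uniform injections are uniform injections: each coordinate of `T′` outside `T`
    -- is a spare draw, which `avg-E` removes.
    E-marginal : ∀ {n} (T T′ : Subset n) A φ → T ⊆ T′ → ∣ T′ ∣ ℕ.≤ ∣ A ∣ → LocalTo T φ → E T′ A φ ≡ E T A φ
    E-marginal [] [] A φ T⊆ le loc = refl
    E-marginal (false ∷ T) (false ∷ T′) A φ T⊆ le loc =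
      E-marginal T T′ A _ (drop-∷-⊆ T⊆) le (λ h h′ e → loc _ _ λ { (there i∈) → e i∈ })
    E-marginal (true ∷ T) (true ∷ T′) A φ T⊆ le loc = avg-cong A λ {a} a∈A →
      E-marginal T T′ (A - a) _ (drop-∷-⊆ T⊆) (k<∣p∣⇒k≤∣p-x∣ A a∈A le)
        (λ h h′ e → loc _ _ (agree-∷ T e))
    E-marginal (true ∷ T) (false ∷ T′) A φ T⊆ le loc with () ← T⊆ here
    E-marginal (false ∷ T) (true ∷ T′) A φ T⊆ le loc = begin
      avg A (λ a → E T′ (A - a) (φ ∘ (a ∷_)))
        -- By locality `φ` does not see this coordinate, so the drawn value can be replaced by the
        -- junk value `c₀`.
        ≡⟨ avg-cong A (λ {a} _ → E-cong T′ (A - a) λ h → loc _ _ λ { (there _) → refl }) ⟩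
      avg A (λ a → E T′ (A - a) (φ ∘ (c₀ ∷_)))
        ≡⟨ avg-cong A (λ {a} a∈A → E-marginal T T′ (A - a) _ (drop-∷-⊆ T⊆) (k<∣p∣⇒k≤∣p-x∣ A a∈A le)
             (λ h h′ e → loc _ _ λ { (there i∈) → e i∈ })) ⟩
      avg A (λ a → E T (A - a) (φ ∘ (c₀ ∷_)))
        ≡⟨ avg-E T A _ (ℕ.≤-trans (ℕ.s≤s (p⊆q⇒∣p∣≤∣q∣ (drop-∷-⊆ T⊆))) le) ⟩
      E T A (φ ∘ (c₀ ∷_)) ∎
      where open ≡-Reasoning

-- Arc graphs and their functoriality.

src tgt : Fin (n ℕ.* n) → Fin n
src {n} x = proj₁ (remQuot {n} n x)
tgt {n} x = proj₂ (remQuot {n} n x)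

src-combine : (u v : Fin n) → src (combine u v) ≡ u
src-combine u v = cong proj₁ (remQuot-combine u v)

tgt-combine : (u v : Fin n) → tgt (combine u v) ≡ v
tgt-combine u v = cong proj₂ (remQuot-combine u v)

-- The arc graph.  All pairs of vertices of G are vertices of δ G; those that
-- are not arcs of G are isolated.
δ : Str → Str
δ G = record
  { size = size G ℕ.* size G
  ; R    = λ x y → R G (src x) (tgt x) × _≡_ {A = Fin (size G)} (tgt x) (src y) × R G (src y) (tgt y)
  }

δ^ : ℕ → Str → Str
δ^ zero    G = G
δ^ (suc j) G = δ (δ^ j G)

R-δ-combine : ∀ {G u v w} → R G u v → R G v w → R (δ G) (combine u v) (combine v w)
R-δ-combine {G} {u} {v} {w} uv vw
  rewrite src-combine u v | tgt-combine u v | src-combine v w | tgt-combine v w = uv , refl , vw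

Hom-∘ : ∀ {F G H} → Hom G H → Hom F G → Hom F H
Hom-∘ (g , g-hom) (f , f-hom) = g ∘ f , λ x y → g-hom (f x) (f y) ∘ f-hom x y

δ-Hom : Hom G H → Hom (δ G) (δ H)
δ-Hom {G} {H} (f , f-hom) = (λ x → combine (f (src x)) (f (tgt x))) , λ x y (xR , x≡y , yR) →
  subst (λ v → R (δ H) (combine (f (src x)) (f (tgt x))) (combine v (f (tgt y)))) (cong f x≡y)
    (R-δ-combine {H} (f-hom _ _ xR)
      (subst (λ v → R H v (f (tgt y))) (cong f (sym x≡y)) (f-hom _ _ yR)))

K-mono : ∀ {m n} → m ℕ.≤ n → Hom (K m) (K n)
K-mono m≤n = (λ a → inject≤ a m≤n) , λ a b a≢b → a≢b ∘ inject≤-injective m≤n m≤n a b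

-- Many colours are needed: from arc colourings to vertex colourings.

funToFin-cong : ∀ {m n} {f g : Fin m → Fin n} → (∀ i → f i ≡ g i) → funToFin f ≡ funToFin g
funToFin-cong {zero}  e = refl
funToFin-cong {suc m} e = cong₂ combine (e zero) (funToFin-cong (e ∘ suc))

finToFun-injective : ∀ {m n} (x y : Fin (n ℕ.^ m)) →
                     (∀ i → finToFun {n} {m} x i ≡ finToFun y i) → x ≡ y
finToFun-injective {m} {n} x y e =
  trans (sym (funToFin-finToFin {m} {n} x)) (trans (funToFin-cong e) (funToFin-finToFin {m} {n} y))

δ^-R? : ∀ j {N} → ∀ x y → Dec (R (δ^ j (K N)) x y)
δ^-R? zero    x y = ¬? (x ≟ y)
δ^-R? (suc j) x y = δ^-R? j (src x) (tgt x) ×-dec (tgt x ≟ src y ×-dec δ^-R? j (src y) (tgt y))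

-- A vertex u gets the set of colours of the arcs leaving u.  For an arc (u , v)
-- this set contains the colour of (u , v), which no arc leaving v can have.
δ-colouring⇒colouring : ∀ {G d} → (∀ x y → Dec (R G x y)) → Hom (δ G) (K d) → Hom G (K (2 ℕ.^ d))
δ-colouring⇒colouring {G} {d} R? (γ , γ-hom) = (λ u → funToFin (colours u)) , λ u v uv eq →
  let eq-at : ∀ a → colours u a ≡ colours v a
      eq-at a = trans (sym (finToFun-funToFin (colours u) a))
                  (trans (cong (λ x → finToFun x a) eq) (finToFun-funToFin (colours v) a))
      (w , vw , same) = colours-sound v _
        (trans (sym (eq-at _)) (colours-complete u _ (v , uv , refl)))
  in γ-hom (combine u v) (combine v w) (R-δ-combine {G} uv vw) (sym same)
  where
  leaves? : ∀ u a → Dec (∃ λ w → R G u w × γ (combine u w) ≡ a)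
  leaves? u a = any? (λ w → R? u w ×-dec γ (combine u w) ≟ a)

  colours : Fin (size G) → Fin d → Fin 2
  colours u a = if does (leaves? u a) then suc zero else zero

  colours-sound : ∀ u a → colours u a ≡ suc zero → ∃ λ w → R G u w × γ (combine u w) ≡ a
  colours-sound u a eq with leaves? u a
  ... | yes p = p
  colours-sound u a () | no _

  colours-complete : ∀ u a → (∃ λ w → R G u w × γ (combine u w) ≡ a) → colours u a ≡ suc zero
  colours-complete u a p with leaves? u a
  ... | yes _ = refl
  ... | no ¬p = contradiction p ¬p

-- The exponential acts on the argument first, matching the removal of the outermost `δ` from `δ^`.
tower : ℕ → ℕ → ℕ
tower zero    d = d
tower (suc j) d = tower j (2 ℕ.^ d)

δ^-colouring⇒colouring : ∀ j {N d} → Hom (δ^ j (K N)) (K d) → Hom (K N) (K (tower j d))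
δ^-colouring⇒colouring zero    γ = γ
δ^-colouring⇒colouring (suc j) γ = δ^-colouring⇒colouring j (δ-colouring⇒colouring (δ^-R? j) γ)

¬Hom-K : ∀ {m n} → m ℕ.< n → ¬ Hom (K n) (K m)
¬Hom-K m<n (γ , γ-hom) = let i , j , i<j , eq = pigeonhole m<n γ in γ-hom i j (<⇒≢ i<j) eq

-- Few colours suffice: colour reduction on iterated arc graphs of small cliques.

-- Cole–Vishkin: an arc (u , v) is coloured by the first position at which the
-- binary codes of u and v differ, together with the bit of u there.
δK-log : ∀ {n} b → 0 ℕ.< b → n ℕ.≤ 2 ℕ.^ b → Hom (δ (K n)) (K (b ℕ.* 2))
δK-log {n} b 0<b n≤2^b = (λ x → colour (src x) (tgt x)) , λ x y (xR , x≡y , yR) eq →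
  colour-proper xR yR (trans eq (cong (λ u → colour u (tgt y)) (sym x≡y))) x≡y
  where
  code : Fin n → Fin b → Fin 2
  code u = finToFun (inject≤ u n≤2^b)

  differ? : ∀ u v → Dec (∃ λ i → code u i ≢ code v i)
  differ? u v = any? (λ i → ¬? (code u i ≟ code v i))

  colour : Fin n → Fin n → Fin (b ℕ.* 2)
  colour u v with differ? u v
  ... | yes (i , _) = combine i (code u i)
  -- A default that never colours an arc, because distinct vertices have distinct codes.
  ... | no _        = combine (fromℕ< 0<b) zero

  codes-agree : ∀ {u v} → ¬ (∃ λ i → code u i ≢ code v i) → u ≡ v
  codes-agree {u} {v} ¬d = inject≤-injective n≤2^b n≤2^b u v (finToFun-injective _ _ λ i →
    decidable-stable (code u i ≟ code v i) (λ ne → ¬d (i , ne)))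

  colour-proper : ∀ {u v v′ w} → u ≢ v → v′ ≢ w → colour u v ≡ colour v w → v ≡ v′ → ⊥
  colour-proper {u} {v} {w = w} u≢v v≢w eq refl with differ? u v | differ? v w
  ... | no ¬d | _ = u≢v (codes-agree ¬d)
  ... | yes _ | no ¬d = v≢w (codes-agree ¬d)
  -- Equal colours mean the same position and the same bit of `u` and `v` there, although the
  -- position was chosen so that these bits differ.
  ... | yes (i , ne) | yes (i′ , _) with combine-injective i (code u i) i′ (code v i′) eq
  ... | refl , eq′ = ne eq′

-- Among the three nonzero colours 1, 2, 3 at most two are forbidden.
avoid₂ : ∀ {n} (p q : Fin (4 ℕ.+ n)) → ∃ λ (y : Fin (3 ℕ.+ n)) → suc y ≢ p × suc y ≢ q
avoid₂ p q with suc zero ≟ p | suc zero ≟ q | suc (suc zero) ≟ p | suc (suc zero) ≟ q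
... | no ≢p   | no ≢q   | _       | _       = zero , ≢p , ≢q
... | yes _   | _       | no ≢p   | no ≢q   = suc zero , ≢p , ≢q
... | _       | yes _   | no ≢p   | no ≢q   = suc zero , ≢p , ≢q
... | yes refl | _      | yes ()  | _
... | yes refl | _      | _       | yes refl = suc (suc zero) , (λ ()) , (λ ())
... | _       | yes refl | yes refl | _      = suc (suc zero) , (λ ()) , (λ ())
... | _       | yes refl | _      | yes ()

-- A walk a , b , c in K (suc n) keeps the colour of b, except that the colour
-- zero is replaced by one different from those of a and c.
δδK-pred : ∀ n → Hom (δ (δ (K (4 ℕ.+ n)))) (K (3 ℕ.+ n))
-- A vertex of the double arc graph that lies on an arc is a pair of consecutive arcs; the three
-- arguments are the vertices of this walk.
δδK-pred n = (λ x → recolour (src (src x)) (tgt (src x)) (tgt (tgt x))) ,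
  λ x y ((_ , b≡b′ , b′≢c) , x≡y , _) → proper b≡b′ b′≢c (cong src x≡y) (cong tgt x≡y)
  where
  V = Fin (4 ℕ.+ n)

  recolour : V → V → V → Fin (3 ℕ.+ n)
  recolour a zero    c = proj₁ (avoid₂ a c)
  recolour a (suc b) c = b

  -- Two neighbours are never both zero, so at most one of them is recoloured, and its new colour
  -- avoids the unchanged colour of the other.
  recolour-≢ : ∀ a b c d → b ≢ c → recolour a b c ≢ recolour b c d
  recolour-≢ a zero    zero    d b≢c eq = b≢c refl
  recolour-≢ a zero    (suc c) d b≢c eq = proj₂ (proj₂ (avoid₂ a (suc c))) (cong suc eq)
  recolour-≢ a (suc b) zero    d b≢c eq = proj₁ (proj₂ (avoid₂ (suc b) d)) (cong suc (sym eq))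
  recolour-≢ a (suc b) (suc c) d b≢c eq = b≢c (cong suc eq)

  proper : ∀ {a b b′ b″ c c″ d} → b ≡ b′ → b′ ≢ c → b′ ≡ b″ → c ≡ c″ →
           recolour a b c ≢ recolour b″ c″ d
  proper {a} {b} {c = c} {d = d} refl b≢c refl refl = recolour-≢ a b c d b≢c

-- Every colour saved costs two arc graphs, by `δδK-pred`.
δ^-reduce : ∀ i m s → Hom (δ^ s G) (K (i ℕ.+ (3 ℕ.+ m))) → Hom (δ^ (i ℕ.* 2 ℕ.+ s) G) (K (3 ℕ.+ m))
δ^-reduce zero    m s γ = γ
δ^-reduce {G} (suc i) m s γ = Hom-∘ {H = K (3 ℕ.+ m)} (δδK-pred m)
  (δ-Hom {H = δ (K (4 ℕ.+ m))} (δ-Hom {H = K (4 ℕ.+ m)}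
    (δ^-reduce {G} i (suc m) s (subst (λ n → Hom (δ^ s G) (K n)) (sym (ℕ.+-suc i (3 ℕ.+ m))) γ))))

-- C = 2 * half s colours are brought down to 12 by s arc graphs.  Each of them
-- multiplies C by 4 but the number of elements involved in a vertex only by 2,
-- so that C / 2 ^ j is unbounded.
half : ℕ → ℕ
half s = 6 ℕ.* 4 ℕ.^ s

-- The inequality 8 b ≤ 2 ^ b fails at b = 5 (40 > 32) and holds from b = 6 on (48 ≤ 64); hence the
-- factor 6 in `half`.
8*[6+n]≤2^[6+n] : ∀ n → 8 ℕ.* (6 ℕ.+ n) ℕ.≤ 2 ℕ.^ (6 ℕ.+ n)
8*[6+n]≤2^[6+n] zero    = ℕ.m≤m+n 48 16
8*[6+n]≤2^[6+n] (suc n) = begin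
  8 ℕ.* (6 ℕ.+ suc n)                     ≡⟨ cong (8 ℕ.*_) (ℕ.+-suc 6 n) ⟩
  8 ℕ.* suc (6 ℕ.+ n)                     ≡⟨ ℕ.*-suc 8 (6 ℕ.+ n) ⟩
  8 ℕ.+ 8 ℕ.* (6 ℕ.+ n)                   ≤⟨ ℕ.+-monoˡ-≤ _ (ℕ.m≤m*n 8 (6 ℕ.+ n)) ⟩
  8 ℕ.* (6 ℕ.+ n) ℕ.+ 8 ℕ.* (6 ℕ.+ n)     ≤⟨ ℕ.+-mono-≤ (8*[6+n]≤2^[6+n] n) (8*[6+n]≤2^[6+n] n) ⟩
  2 ℕ.^ (6 ℕ.+ n) ℕ.+ 2 ℕ.^ (6 ℕ.+ n)     ≡⟨ cong (2 ℕ.^ (6 ℕ.+ n) ℕ.+_) (sym (ℕ.+-identityʳ _)) ⟩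
  2 ℕ.^ (6 ℕ.+ suc n) ∎
  where open ℕ.≤-Reasoning

6≤half : ∀ s → 6 ℕ.≤ half s
6≤half s = ℕ.m≤m*n 6 (4 ℕ.^ s) {{ℕ.m^n≢0 4 s}}

-- The hypothesis of `δK-log` for one round: `half s` bits can code `half (suc s) * 2` colours.
half-suc : ∀ s → half (suc s) ℕ.* 2 ℕ.≤ 2 ℕ.^ half s
half-suc s with ℕ.m≤n⇒∃[o]m+o≡n (6≤half s)
... | o , 6+o≡half = begin
  6 ℕ.* (4 ℕ.* 4 ℕ.^ s) ℕ.* 2  ≡⟨ regroup (4 ℕ.^ s) ⟩
  8 ℕ.* half s                 ≤⟨ subst (λ b → 8 ℕ.* b ℕ.≤ 2 ℕ.^ b) 6+o≡half (8*[6+n]≤2^[6+n] o) ⟩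
  2 ℕ.^ half s ∎
  where
  open ℕ.≤-Reasoning
  regroup : ∀ x → 6 ℕ.* (4 ℕ.* x) ℕ.* 2 ≡ 8 ℕ.* (6 ℕ.* x)
  regroup = solve-∀

δ^K-half : ∀ i s → Hom (δ^ i (K (half (i ℕ.+ s) ℕ.* 2))) (K (half s ℕ.* 2))
δ^K-half zero    s = id , λ _ _ → id
δ^K-half (suc i) s = Hom-∘ {H = K (half s ℕ.* 2)}
  (δK-log (half s) (ℕ.≤-trans (s≤s z≤n) (6≤half s)) (half-suc s))
  (δ-Hom {H = K (half (suc s) ℕ.* 2)}
    (subst (λ n → Hom (δ^ i (K (half n ℕ.* 2))) (K (half (suc s) ℕ.* 2))) (ℕ.+-suc i s) (δ^K-half i (suc s))))

n≤2^n : ∀ n → n ℕ.≤ 2 ℕ.^ n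
n≤2^n zero    = z≤n
n≤2^n (suc n) = ℕ.+-mono-≤ (ℕ.m^n>0 2 n) (ℕ.≤-trans (n≤2^n n) (ℕ.m≤m+n _ 0))

half-dominates : ∀ k i → ∃ λ s → k ℕ.* 2 ℕ.^ (i ℕ.+ s) ℕ.≤ half s ℕ.* 2
-- With s = i + k, the bound k ≤ 2 ^ k turns the left side into at most 2 ^ (2 * (i + k)) = 4 ^ s.
half-dominates k i = i ℕ.+ k , (begin
  k ℕ.* 2 ℕ.^ (i ℕ.+ (i ℕ.+ k))        ≤⟨ ℕ.*-monoˡ-≤ (2 ℕ.^ (i ℕ.+ (i ℕ.+ k))) (n≤2^n k) ⟩
  2 ℕ.^ k ℕ.* 2 ℕ.^ (i ℕ.+ (i ℕ.+ k))  ≡⟨ sym (ℕ.^-distribˡ-+-* 2 k (i ℕ.+ (i ℕ.+ k))) ⟩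
  2 ℕ.^ (k ℕ.+ (i ℕ.+ (i ℕ.+ k)))      ≡⟨ cong (2 ℕ.^_) (exponent i k) ⟩
  2 ℕ.^ (2 ℕ.* (i ℕ.+ k))              ≡⟨ sym (ℕ.^-*-assoc 2 2 (i ℕ.+ k)) ⟩
  4 ℕ.^ (i ℕ.+ k)                      ≤⟨ ℕ.m≤n*m (4 ℕ.^ (i ℕ.+ k)) 6 ⟩
  half (i ℕ.+ k)                       ≤⟨ ℕ.m≤m*n (half (i ℕ.+ k)) 2 ⟩
  half (i ℕ.+ k) ℕ.* 2 ∎)
  where
  open ℕ.≤-Reasoning
  exponent : ∀ i k → k ℕ.+ (i ℕ.+ (i ℕ.+ k)) ≡ 2 ℕ.* (i ℕ.+ k)
  exponent = solve-∀

-- Kept general in i because unfolding a concrete iterate δ^ (i * 2 + s) is infeasible.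
δ^K-colourable′ : ∀ i → half 0 ℕ.* 2 ≡ i ℕ.+ 3 → ∀ k →
                  ∃₂ λ j C → k ℕ.* 2 ℕ.^ j ℕ.≤ C × Hom (δ^ j (K C)) (K 3)
-- The first `s` arc graphs shrink the palette logarithmically, the other `i * 2` remove the last
-- `i` surplus colours; the bound on `C` accounts for both phases.
δ^K-colourable′ i eq k with half-dominates k (i ℕ.* 2)
... | s , bound = i ℕ.* 2 ℕ.+ s , half s ℕ.* 2 , bound ,
  δ^-reduce {K (half s ℕ.* 2)} i 0 s
    (subst (λ n → Hom (δ^ s (K (half s ℕ.* 2))) (K n)) eq
      (subst (λ n → Hom (δ^ s (K (half n ℕ.* 2))) (K (half 0 ℕ.* 2))) (ℕ.+-identityʳ s) (δ^K-half s 0)))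

δ^K-colourable : ∀ k → ∃₂ λ j C → k ℕ.* 2 ℕ.^ j ℕ.≤ C × Hom (δ^ j (K C)) (K 3)
-- `half 0 * 2` is 12, so nine colours remain to be removed.
δ^K-colourable = δ^K-colourable′ 9 refl

-- Supports of vertices, and maps lifted to iterated arc graphs.

supp : ∀ j {N} → Fin (size (δ^ j (K N))) → Subset N
supp zero    x = ⁅ x ⁆
supp (suc j) x = supp j (src x) ∪ supp j (tgt x)

-- The action of `δ^ j` on vertices, for a map that need not be a homomorphism of cliques.
lift : ∀ j {N C} → (Fin N → Fin C) → Fin (size (δ^ j (K N))) → Fin (size (δ^ j (K C)))
lift zero    h x = h x
lift (suc j) h x = combine (lift j h (src x)) (lift j h (tgt x))

∣p∪q∣≤∣p∣+∣q∣ : ∀ {n} (p q : Subset n) → ∣ p ∪ q ∣ ℕ.≤ ∣ p ∣ ℕ.+ ∣ q ∣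
∣p∪q∣≤∣p∣+∣q∣ [] [] = z≤n
∣p∪q∣≤∣p∣+∣q∣ (false ∷ p) (false ∷ q) = ∣p∪q∣≤∣p∣+∣q∣ p q
∣p∪q∣≤∣p∣+∣q∣ (false ∷ p) (true  ∷ q) =
  subst (suc ∣ p ∪ q ∣ ℕ.≤_) (sym (ℕ.+-suc ∣ p ∣ ∣ q ∣)) (s≤s (∣p∪q∣≤∣p∣+∣q∣ p q))
∣p∪q∣≤∣p∣+∣q∣ (true  ∷ p) (false ∷ q) = s≤s (∣p∪q∣≤∣p∣+∣q∣ p q)
∣p∪q∣≤∣p∣+∣q∣ (true  ∷ p) (true  ∷ q) =
  s≤s (ℕ.≤-trans (∣p∪q∣≤∣p∣+∣q∣ p q) (ℕ.+-monoʳ-≤ ∣ p ∣ (ℕ.n≤1+n ∣ q ∣)))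

∣supp∣≤2^j : ∀ j {N} x → ∣ supp j {N} x ∣ ℕ.≤ 2 ℕ.^ j
∣supp∣≤2^j zero    x = ℕ.≤-reflexive (∣⁅x⁆∣≡1 x)
∣supp∣≤2^j (suc j) x = ℕ.≤-trans (∣p∪q∣≤∣p∣+∣q∣ (supp j (src x)) (supp j (tgt x)))
  (ℕ.+-mono-≤ (∣supp∣≤2^j j (src x)) (ℕ.≤-trans (∣supp∣≤2^j j (tgt x)) (ℕ.m≤m+n _ 0)))

lift-local : ∀ j {N C} {h h′ : Fin N → Fin C} x →
             (∀ {i} → i ∈ supp j x → h i ≡ h′ i) → lift j h x ≡ lift j h′ x
lift-local zero    x e = e (x∈⁅x⁆ x)
lift-local (suc j) x e = cong₂ combine
  (lift-local j (src x) (e ∘ x∈p∪q⁺ ∘ inj₁))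
  (lift-local j (tgt x) (e ∘ x∈p∪q⁺ ∘ inj₂))

-- Unfolding an arc down to `K N` leaves only conditions that two elements of the supports are
-- distinct, which a map injective on the supports preserves.
lift-R : ∀ j {N C} {h : Fin N → Fin C} x y →
         (∀ {i i′} → i ∈ supp j x ∪ supp j y → i′ ∈ supp j x ∪ supp j y → h i ≡ h i′ → i ≡ i′) →
         R (δ^ j (K N)) x y → R (δ^ j (K C)) (lift j h x) (lift j h y)
lift-R zero    x y inj x≢y eq = x≢y (inj (x∈p∪q⁺ (inj₁ (x∈⁅x⁆ x))) (x∈p∪q⁺ (inj₂ (x∈⁅x⁆ y))) eq)
lift-R (suc j) {C = C} {h} x y inj (xR , x≡y , yR) =
  subst (λ v → R (δ (δ^ j (K C))) (lift (suc j) h x) (combine v (lift j h (tgt y)))) (cong (lift j h) x≡y)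
    (R-δ-combine {δ^ j (K C)}
      (lift-R j (src x) (tgt x) (λ i∈ i′∈ → inj (x∈p∪q⁺ (inj₁ i∈)) (x∈p∪q⁺ (inj₁ i′∈))) xR)
      (subst (λ v → R (δ^ j (K C)) v (lift j h (tgt y))) (cong (lift j h) (sym x≡y))
        (lift-R j (src y) (tgt y) (λ i∈ i′∈ → inj (x∈p∪q⁺ (inj₂ i∈)) (x∈p∪q⁺ (inj₂ i′∈))) yR)))

-- Elements involved in a set of vertices.

scope : ∀ {n N} → (Fin n → Subset N) → Subset n → Subset N
scope s []          = ∅
scope s (true  ∷ V) = s zero ∪ scope (s ∘ suc) V
scope s (false ∷ V) = scope (s ∘ suc) V

∈-scope : ∀ {n N} (s : Fin n → Subset N) {V x i} → x ∈ V → i ∈ s x → i ∈ scope s V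
∈-scope s here i∈ = x∈p∪q⁺ (inj₁ i∈)
∈-scope s {true  ∷ V} (there x∈) i∈ = x∈p∪q⁺ (inj₂ (∈-scope (s ∘ suc) x∈ i∈))
∈-scope s {false ∷ V} (there x∈) i∈ = ∈-scope (s ∘ suc) x∈ i∈

∈-scope⁻ : ∀ {n N} (s : Fin n → Subset N) V {i} → i ∈ scope s V → ∃ λ x → x ∈ V × i ∈ s x
∈-scope⁻ s []         i∈ = contradiction i∈ ∉⊥
∈-scope⁻ s (false ∷ V) i∈ with x , x∈ , i∈x ← ∈-scope⁻ (s ∘ suc) V i∈ = suc x , there x∈ , i∈x
∈-scope⁻ s (true ∷ V) i∈ with x∈p∪q⁻ (s zero) _ i∈
... | inj₁ i∈₀ = zero , here , i∈₀
... | inj₂ i∈ᵥ with x , x∈ , i∈x ← ∈-scope⁻ (s ∘ suc) V i∈ᵥ = suc x , there x∈ , i∈x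

scope-mono : ∀ {n N} (s : Fin n → Subset N) {U V} → U ⊆ V → scope s U ⊆ scope s V
scope-mono s {U} U⊆V i∈ with x , x∈ , i∈x ← ∈-scope⁻ s U i∈ = ∈-scope s (U⊆V x∈) i∈x

∣scope∣≤ : ∀ {n N m} (s : Fin n → Subset N) → (∀ x → ∣ s x ∣ ℕ.≤ m) → ∀ V → ∣ scope s V ∣ ℕ.≤ ∣ V ∣ ℕ.* m
∣scope∣≤ {N = N} s le [] = ℕ.≤-reflexive (∣⊥∣≡0 N)
∣scope∣≤ s le (true  ∷ V) = ℕ.≤-trans (∣p∪q∣≤∣p∣+∣q∣ (s zero) _)
  (ℕ.+-mono-≤ (le zero) (∣scope∣≤ (s ∘ suc) (le ∘ suc) V))
∣scope∣≤ s le (false ∷ V) = ∣scope∣≤ (s ∘ suc) (le ∘ suc) V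

-- Restrictions of colourings, encoded as partial assignments.

painting : ∀ {n p} → (Fin n → Fin p) → Subset n → PAssign n p
painting γ []      = []
painting γ (b ∷ V) = (if b then just (γ zero) else nothing) ∷ painting (γ ∘ suc) V

painting-cong : ∀ {n p} {γ γ′ : Fin n → Fin p} V → (∀ {x} → x ∈ V → γ x ≡ γ′ x) →
                painting γ V ≡ painting γ′ V
painting-cong []          e = refl
painting-cong (true  ∷ V) e = cong₂ _∷_ (cong just (e here)) (painting-cong V (e ∘ there))
painting-cong (false ∷ V) e = cong (nothing ∷_) (painting-cong V (e ∘ there))

dom-painting : ∀ {n p} (γ : Fin n → Fin p) V → dom (painting γ V) ≡ V
dom-painting γ []          = refl
dom-painting γ (true  ∷ V) = cong (true ∷_) (dom-painting (γ ∘ suc) V)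
dom-painting γ (false ∷ V) = cong (false ∷_) (dom-painting (γ ∘ suc) V)

lookup-painting : ∀ {n p} (γ : Fin n → Fin p) {V x} → x ∈ V → lookup (painting γ V) x ≡ just (γ x)
lookup-painting γ here       = refl
lookup-painting γ (there x∈) = lookup-painting (γ ∘ suc) x∈

restrict-painting : ∀ {n p} (γ : Fin n → Fin p) {U V} → U ⊆ V → restrict U (painting γ V) ≡ painting γ U
restrict-painting γ {[]}        {[]}        U⊆V = refl
restrict-painting γ {true  ∷ U} {true  ∷ V} U⊆V = cong (just (γ zero) ∷_) (restrict-painting (γ ∘ suc) (drop-∷-⊆ U⊆V))
restrict-painting γ {true  ∷ U} {false ∷ V} U⊆V with () ← U⊆V here
restrict-painting γ {false ∷ U} {_     ∷ V} U⊆V = cong (nothing ∷_) (restrict-painting (γ ∘ suc) (drop-∷-⊆ U⊆V))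

dom-assignsOn : ∀ {n p} (V : Subset n) {g} → g List.∈ assignsOn p V → dom g ≡ V
dom-assignsOn []          (here refl) = refl
dom-assignsOn {p = p} (true ∷ V) g∈
  with a , g∈ᵃ ← Any.satisfied (∈-concatMap⁻ (λ a → map (just a ∷_) (assignsOn p V)) {xs = allFin p} g∈)
  with g′ , g′∈ , refl ← ∈-map⁻ (just a ∷_) g∈ᵃ = cong (true ∷_) (dom-assignsOn V g′∈)
dom-assignsOn {p = p} (false ∷ V) g∈
  with g′ , g′∈ , refl ← ∈-map⁻ (nothing ∷_) g∈ = cong (false ∷_) (dom-assignsOn V g′∈)

-- The enumeration `assignsOn p (dom q)` contains `q` exactly once, so the indicator selects a
-- single term.
∑-assignsOn-𝟙 : ∀ {n p} (q : PAssign n p) (F : PAssign n p → ℚ) →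
                ∑ (assignsOn p (dom q)) (λ g → 𝟙 (q ≟PA g) * F g) ≡ F q
∑-assignsOn-𝟙 [] F = trans (+-identityʳ _) (*-identityˡ (F []))
∑-assignsOn-𝟙 {p = p} (nothing ∷ q) F = begin
  ∑ (map (nothing ∷_) (assignsOn p (dom q))) (λ g → 𝟙 ((nothing ∷ q) ≟PA g) * F g)
    ≡⟨ ∑-map (nothing ∷_) (assignsOn p (dom q)) _ ⟩
  ∑ (assignsOn p (dom q)) (λ g → 𝟙 ((nothing ∷ q) ≟PA (nothing ∷ g)) * F (nothing ∷ g))
    ≡⟨ ∑-cong (assignsOn p (dom q)) (λ g → cong (_* F (nothing ∷ g))
         (𝟙-⇔ ((nothing ∷ q) ≟PA (nothing ∷ g)) (q ≟PA g) (mk⇔ ∷-injectiveʳ (cong (nothing ∷_))))) ⟩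
  ∑ (assignsOn p (dom q)) (λ g → 𝟙 (q ≟PA g) * F (nothing ∷ g))
    ≡⟨ ∑-assignsOn-𝟙 q (F ∘ (nothing ∷_)) ⟩
  F (nothing ∷ q) ∎
  where open ≡-Reasoning
∑-assignsOn-𝟙 {p = p} (just b ∷ q) F = begin
  ∑ (assignsOn p (dom (just b ∷ q))) (λ g → 𝟙 ((just b ∷ q) ≟PA g) * F g)
    ≡⟨ ∑-concatMap (λ a → map (just a ∷_) gs) (allFin p) _ ⟩
  ∑ (allFin p) (λ a → ∑ (map (just a ∷_) gs) (λ g → 𝟙 ((just b ∷ q) ≟PA g) * F g))
    ≡⟨ ∑-cong (allFin p) (λ a → trans (∑-map (just a ∷_) gs _) (trans (∑-cong gs (split a)) (∑-*ˡ gs (𝟙 (b ≟ a)) _))) ⟩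
  ∑ (allFin p) (λ a → 𝟙 (b ≟ a) * ∑ gs (λ g → 𝟙 (q ≟PA g) * F (just a ∷ g)))
    ≡⟨ ∑-𝟙≟ b _ ⟩
  ∑ gs (λ g → 𝟙 (q ≟PA g) * F (just b ∷ g))
    ≡⟨ ∑-assignsOn-𝟙 q (F ∘ (just b ∷_)) ⟩
  F (just b ∷ q) ∎
  where
  open ≡-Reasoning
  gs = assignsOn p (dom q)
  split : ∀ a g → 𝟙 ((just b ∷ q) ≟PA (just a ∷ g)) * F (just a ∷ g) ≡
                  𝟙 (b ≟ a) * (𝟙 (q ≟PA g) * F (just a ∷ g))
  split a g = trans
    (cong (_* F (just a ∷ g)) (trans
      (𝟙-⇔ ((just b ∷ q) ≟PA (just a ∷ g)) (b ≟ a ×-dec q ≟PA g)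
        (mk⇔ (λ eq → just-injective (∷-injectiveˡ eq) , ∷-injectiveʳ eq) (λ { (refl , refl) → refl })))
      (sym (𝟙-× (b ≟ a) (q ≟PA g)))))
    (*-assoc (𝟙 (b ≟ a)) (𝟙 (q ≟PA g)) (F (just a ∷ g)))

-- Sherali-Adams solutions from random local colourings.

module _
  (X : Str) {N C c : ℕ} (c₀ : Fin C)
  (s : Fin (size X) → Subset N)
  (paint : Vec (Fin C) N → Fin (size X) → Fin c)
  (paint-local : ∀ {h h′} x → Agree (s x) h h′ → paint h x ≡ paint h′ x)
  (paint-proper : ∀ {h} x y → InjectiveOn (s x ∪ s y) h → R X x y → paint h x ≢ paint h y)
  {m} (∣s∣≤m : ∀ x → ∣ s x ∣ ℕ.≤ m)
  -- The summand 2 makes room for both ends of an arc even when k < 2.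
  (k : ℕ) (fits : (2 ℕ.+ k) ℕ.* m ℕ.≤ C)
  where

  private
    𝔼 : Subset (size X) → (Vec (Fin C) N → ℚ) → ℚ
    𝔼 V = E c₀ (scope s V) ⊤

    -- The probability that the random colouring of `dom f` is `f`. Only the scope of `dom f` is
    -- injected into [C], as all of [N] need not fit.
    weight : PAssign (size X) c → ℚ
    weight f = 𝔼 (dom f) (λ h → 𝟙 (painting (paint h) (dom f) ≟PA f))

    scope-fits : ∀ V → ∣ V ∣ ℕ.≤ 2 ℕ.+ k → ∣ scope s V ∣ ℕ.≤ ∣ ⊤ {C} ∣
    scope-fits V le = subst (∣ scope s V ∣ ℕ.≤_) (sym (∣⊤∣≡n C))
      (ℕ.≤-trans (∣scope∣≤ s ∣s∣≤m V) (ℕ.≤-trans (ℕ.*-monoˡ-≤ m le) fits))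

    𝔼-const : ∀ V q → ∣ V ∣ ℕ.≤ 2 ℕ.+ k → 𝔼 V (λ _ → q) ≡ q
    𝔼-const V q le = E-const c₀ (scope s V) ⊤ q (scope-fits V le)

    -- Law of the unconscious statistician for the random colouring of `V`. The constant 1 yields
    -- SA1, an indicator of a restriction yields SA2 and SA3.
    ∑-weight : ∀ V (F : PAssign (size X) c → ℚ) →
               ∑ (assignsOn c V) (λ g → F g * weight g) ≡ 𝔼 V (λ h → F (painting (paint h) V))
    ∑-weight V F = begin
      ∑ (assignsOn c V) (λ g → F g * weight g)
        ≡⟨ ∑-cong-∈ (assignsOn c V) (λ {g} g∈ → cong (λ U → F g * 𝔼 U (λ h → 𝟙 (painting (paint h) U ≟PA g)))
             (dom-assignsOn V g∈)) ⟩
      ∑ (assignsOn c V) (λ g → F g * 𝔼 V (λ h → 𝟙 (painting (paint h) V ≟PA g)))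
        ≡⟨ ∑-cong (assignsOn c V) (λ g → sym (E-*ˡ c₀ (scope s V) ⊤ (F g) _)) ⟩
      ∑ (assignsOn c V) (λ g → 𝔼 V (λ h → F g * 𝟙 (painting (paint h) V ≟PA g)))
        ≡⟨ sym (E-∑ c₀ (scope s V) ⊤ (assignsOn c V) _) ⟩
      𝔼 V (λ h → ∑ (assignsOn c V) (λ g → F g * 𝟙 (painting (paint h) V ≟PA g)))
        ≡⟨ E-cong c₀ (scope s V) ⊤ (λ h → trans
             (∑-cong (assignsOn c V) (λ g → *-comm (F g) (𝟙 (painting (paint h) V ≟PA g))))
             (subst (λ U → ∑ (assignsOn c U) (λ g → 𝟙 (painting (paint h) V ≟PA g) * F g) ≡ F (painting (paint h) V))
               (dom-painting (paint h) V) (∑-assignsOn-𝟙 (painting (paint h) V) F))) ⟩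
      𝔼 V (λ h → F (painting (paint h) V)) ∎
      where open ≡-Reasoning

    -- Serves SA2 and SA3 alike, since arcs get the same weights as vertex sets. Summing out `V`
    -- leaves an event that depends on `h` only within the scope of `U`, and `E-marginal` shrinks
    -- the injection to that scope.
    consistent : ∀ U V → U ⊆ V → ∣ V ∣ ℕ.≤ 2 ℕ.+ k → ∀ f → dom f ≡ U → weight f ≡ sumExt weight V U f
    consistent U V U⊆V le f refl = sym (begin
      sumExt weight V U f
        ≡⟨ ∑-filter (λ g → restrict U g ≟PA f) (assignsOn c V) weight ⟩
      ∑ (assignsOn c V) (λ g → 𝟙 (restrict U g ≟PA f) * weight g)
        ≡⟨ ∑-weight V (λ g → 𝟙 (restrict U g ≟PA f)) ⟩
      𝔼 V (λ h → 𝟙 (restrict U (painting (paint h) V) ≟PA f))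
        ≡⟨ E-cong c₀ (scope s V) ⊤ (λ h → cong (λ g → 𝟙 (g ≟PA f)) (restrict-painting (paint h) U⊆V)) ⟩
      𝔼 V (λ h → 𝟙 (painting (paint h) U ≟PA f))
        ≡⟨ E-marginal c₀ (scope s U) (scope s V) ⊤ _ (scope-mono s U⊆V) (scope-fits V le) (λ h h′ agree →
             cong (λ g → 𝟙 (g ≟PA f))
               (painting-cong U (λ {x} x∈ → paint-local x (λ i∈ → agree (∈-scope s x∈ i∈))))) ⟩
      weight f ∎)
      where open ≡-Reasoning

    weight-inUnit : ∀ f → ∣ dom f ∣ ℕ.≤ 2 ℕ.+ k → inUnit (weight f)
    weight-inUnit f le =
        subst (ℚ._≤ weight f) (𝔼-const (dom f) 0ℚ le)
          (E-mono c₀ (scope s (dom f)) ⊤ (λ h → 𝟙-nonNeg (painting (paint h) (dom f) ≟PA f)))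
      , subst (weight f ℚ.≤_) (𝔼-const (dom f) 1ℚ le)
          (E-mono c₀ (scope s (dom f)) ⊤ (λ h → 𝟙≤1 (painting (paint h) (dom f) ≟PA f)))

    total : ∀ V → ∣ V ∣ ℕ.≤ 2 ℕ.+ k → sumℚ (map weight (assignsOn c V)) ≡ 1ℚ
    total V le = trans (∑-cong (assignsOn c V) (λ g → sym (*-identityˡ (weight g))))
      (trans (∑-weight V (λ _ → 1ℚ)) (𝔼-const V 1ℚ le))

    ∣pair∣≤2 : ∀ (x y : Fin (size X)) → ∣ pair x y ∣ ℕ.≤ 2 ℕ.+ k
    ∣pair∣≤2 x y = ℕ.≤-trans (∣p∪q∣≤∣p∣+∣q∣ ⁅ x ⁆ ⁅ y ⁆)
      (subst (ℕ._≤ 2 ℕ.+ k) (sym (cong₂ ℕ._+_ (∣⁅x⁆∣≡1 x) (∣⁅x⁆∣≡1 y))) (ℕ.m≤m+n 2 k))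

    -- Every injection on the scope paints the ends of an arc differently, so none of them produces
    -- `f`.
    improper⇒0 : ∀ x y → R X x y → ∀ f → dom f ≡ pair x y → ∀ {a} →
                 lookup f x ≡ just a → lookup f y ≡ just a → weight f ≡ 0ℚ
    improper⇒0 x y e f dom≡ fx fy = trans
      (E-cong-injective c₀ (scope s (dom f)) ⊤ (λ h _ inj → 𝟙-no (painting (paint h) (dom f) ≟PA f) λ p≡f →
        paint-proper x y (λ i∈ j∈ → inj (supports i∈) (supports j∈)) e
          (just-injective (trans (painted h p≡f x∈ fx) (sym (painted h p≡f y∈ fy))))))
      (𝔼-const (dom f) 0ℚ (subst (λ V → ∣ V ∣ ℕ.≤ 2 ℕ.+ k) (sym dom≡) (∣pair∣≤2 x y)))
      where
      x∈ : x ∈ dom f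
      x∈ = subst (x ∈_) (sym dom≡) (x∈p∪q⁺ (inj₁ (x∈⁅x⁆ x)))
      y∈ : y ∈ dom f
      y∈ = subst (y ∈_) (sym dom≡) (x∈p∪q⁺ (inj₂ (x∈⁅x⁆ y)))
      supports : s x ∪ s y ⊆ scope s (dom f)
      supports i∈ with x∈p∪q⁻ (s x) (s y) i∈
      ... | inj₁ i∈x = ∈-scope s x∈ i∈x
      ... | inj₂ i∈y = ∈-scope s y∈ i∈y
      painted : ∀ h → painting (paint h) (dom f) ≡ f → ∀ {z a} → z ∈ dom f → lookup f z ≡ just a →
                just (paint h z) ≡ just a
      painted h p≡f {z} z∈ fz = trans (sym (lookup-painting (paint h) z∈)) (trans (cong (λ g → lookup g z) p≡f) fz)

  locallyColourable⇒SA : SASolution k X (K c)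
  locallyColourable⇒SA = record
    { lamV   = weight
    ; lamR   = λ _ _ _ → weight
    ; rangeV = λ f _ le → weight-inUnit f (≤2+k le)
    ; rangeR = λ x y _ f dom≡ → weight-inUnit f (subst (λ V → ∣ V ∣ ℕ.≤ 2 ℕ.+ k) (sym dom≡) (∣pair∣≤2 x y))
    ; SA1    = λ V _ le → total V (≤2+k le)
    ; SA2    = λ U V U⊆V _ le → consistent U V U⊆V (≤2+k le)
    ; SA3    = λ x y _ U U⊆ _ _ → consistent U (pair x y) U⊆ (∣pair∣≤2 x y)
    -- A pair forbidden by `K c` satisfies only ¬ (a ≢ b); decidable equality turns this into
    -- `a ≡ b`.
    ; SA4    = λ x y e f dom≡ a b fx fy ¬a≢b → improper⇒0 x y e f dom≡ fx
                 (trans fy (cong just (sym (decidable-stable (a ≟ b) ¬a≢b))))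
    }
    where
    ≤2+k : ∀ {n} → n ℕ.≤ k → n ℕ.≤ 2 ℕ.+ k
    ≤2+k le = ℕ.≤-trans le (ℕ.m≤n+m k 2)

-- The integrality gap and the conclusion.

SA-gap : ∀ k c d {j C} → (2 ℕ.+ k) ℕ.* 2 ℕ.^ j ℕ.≤ C → Hom (δ^ j (K C)) (K c) →
         ∃ λ X → SASolution k X (K c) × ¬ Hom X (K d)
SA-gap k c d {j} {C} fits (γ , γ-hom) =
  δ^ j (K N) , solution , ¬Hom-K (ℕ.n<1+n (tower j d)) ∘ δ^-colouring⇒colouring j
  where
  -- One more than the number of colours that a `d`-colouring of `δ^ j (K N)` would yield for `K N`.
  N = suc (tower j d)

  0<C : 0 ℕ.< C
  0<C = ℕ.<-≤-trans (ℕ.m^n>0 2 j) (ℕ.≤-trans (ℕ.m≤n*m (2 ℕ.^ j) (2 ℕ.+ k)) fits)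

  solution : SASolution k (δ^ j (K N)) (K c)
  solution = locallyColourable⇒SA (δ^ j (K N)) (fromℕ< 0<C) (supp j)
    (λ h x → γ (lift j (lookup h) x))
    (λ x agree → cong γ (lift-local j x agree))
    (λ x y inj e → γ-hom _ _ (lift-R j x y inj e))
    (∣supp∣≤2^j j) k fits

theorem3p6 : ∀ (c d : ℕ) → 3 ≤ c → c ≤ d → ¬ Σ ℕ (λ k → SAsolves k (K c) (K d))
theorem3p6 c d 3≤c _ (k , solves) = refute (δ^K-colourable (2 ℕ.+ k))
  where
  refute : ¬ (∃₂ λ j C → (2 ℕ.+ k) ℕ.* 2 ℕ.^ j ℕ.≤ C × Hom (δ^ j (K C)) (K 3))
  refute (j , C , fits , γ) with SA-gap k c d {j} fits (Hom-∘ {H = K c} (K-mono 3≤c) γ)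
  -- The accepted instance has no homomorphism to `K d`, against the soundness condition (ii).
  ... | X , solution , ¬X→K = ¬X→K (proj₂ (solves X) solution)
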